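{- Let $t$ be a term of the silly substitution calculus. If $t\to_w^* n$ with $n$ a $\to_w$-normal term, then there is a derivation $\pi\triangleright\Gamma\vdash t:\mathtt{n}$ in the silly multi type system, for some type context $\Gamma$.
   Context: Terms: $t ::= x \mid \lambda x.t \mid t\,u \mid t[x\backslash u]$ ($t[x\backslash u]$ an explicit substitution binding $x$ in $t$; terms up to $\alpha$). Values $v ::= \lambda x.t$. Substitution contexts $S ::= \langle\cdot\rangle\mid S[x\backslash u]$. Weak contexts $W ::= \langle\cdot\rangle \mid W\,t \mid t\,W \mid t[x\backslash W] \mid W[x\backslash u]$; $W\langle\langle t\rangle\rangle$ is plugging without capture of free variables of $t$. Root rules: $S\langle\lambda x.t\rangle u\mapsto_m S\langle t[x\backslash u]\rangle$; $W\langle\langle x\rangle\rangle[x\backslash u]\mapsto_e W\langle\langle u\rangle\rangle[x\backslash u]$; $t[x\backslash S\langle v\rangle]\mapsto_{gcv} S\langle t\rangle$ if $x\notin\mathrm{fv}(t)$. $\to_w$ is the union of their closures under weak contexts. Silly multi types: linear types $L ::= \mathtt{n} \mid M\multimap L$; multi types $M ::= [L_i]_{i\in I}$ finite multisets ($\mathbf{0}$ empty, $\uplus$ sum). Type contexts $\Gamma$ map variables to multi types with finite support; $\uplus$ pointwise; $\Gamma\setminus\!\!\setminus x$ sets $x$ to $\mathbf{0}$. Judgements $\Gamma\vdash^{(m,e)} t:T$ ($\Gamma\vdash t:T$ when indices are irrelevant). Rules: (ax) $x:[L]\vdash^{(0,1)} x:L$; (many) from $(\Gamma_i\vdash^{(m_i,e_i)}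 t : L_i)_{i\in I}$, $I$ finite possibly empty, infer $\uplus_i\Gamma_i\vdash^{(\sum m_i,\sum e_i)} t : [L_i]_{i\in I}$; ($\mathrm{ax}_\lambda$) $\vdash^{(0,0)}\lambda x.t:\mathtt{n}$; ($\lambda$) from $\Gamma\vdash^{(m,e)}t:L$ infer $\Gamma\setminus\!\!\setminus x\vdash^{(m,e)}\lambda x.t:\Gamma(x)\multimap L$; (@) from $\Gamma\vdash^{(m,e)} t : M\multimap L$ and $\Delta\vdash^{(m',e')} u : M\uplus[\mathtt{n}]$ infer $\Gamma\uplus\Delta\vdash^{(m+m'+1,e+e')} tu : L$; (ES) from $\Gamma\vdash^{(m,e)} t:L$ and $\Delta\vdash^{(m',e')}u:\Gamma(x)\uplus[\mathtt{n}]$ infer $(\Gamma\setminus\!\!\setminus x)\uplus\Delta\vdash^{(m+m',e+e')} t[x\backslash u]:L$. -}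

module Defs where

open import Data.Fin.Base using (Fin; zero; suc)
open import Data.List.Base using (List; []; [_]; _++_)
open import Data.List.Relation.Binary.Permutation.Homogeneous using (Permutation)
open import Data.Nat.Base using (ℕ; zero; suc; _+_)
open import Data.Vec.Functional using (Vector; head; tail; replicate; updateAt; zipWith; foldr; toList)
open import Function.Base using (_∘_; id; const)
open import Level using (0ℓ)
open import Relation.Binary.Construct.Union using (_∪_)
open import Relation.Binary.Core using (Rel)

-- Terms up to α are well-scoped de Bruijn terms: Tm k has its free variables
-- among k variables.  In t [∖ u ], index zero is bound in t but not in u.

infixl 7 _·_
infixl 8 _[∖_]

data Tm (k : ℕ) : Set where
  var   : Fin k → Tm k
  ƛ_    : Tm (suc k) → Tm k
  _·_   : Tm k → Tm k → Tm k
  _[∖_] : Tm (suc k) → Tm k → Tm k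

data Value {k : ℕ} : Tm k → Set where
  ƛ_ : (t : Tm (suc k)) → Value (ƛ t)

Ren : ℕ → ℕ → Set
Ren k l = Fin k → Fin l

liftRen : ∀ {k l} → Ren k l → Ren (suc k) (suc l)
liftRen ρ zero    = zero
liftRen ρ (suc x) = suc (ρ x)

ren : ∀ {k l} → Ren k l → Tm k → Tm l
ren ρ (var x)    = var (ρ x)
ren ρ (ƛ t)      = ƛ ren (liftRen ρ) t
ren ρ (t · u)    = ren ρ t · ren ρ u
ren ρ (t [∖ u ]) = ren (liftRen ρ) t [∖ ren ρ u ]

weaken : ∀ {k} → Tm k → Tm (suc k)
weaken = ren suc

-- In SCtx k l and WCtx k l, k is the scope of the whole context and l the scope
-- at the hole, i.e. k extended with the variables bound on the path to the hole.

data SCtx (k : ℕ) : ℕ → Set where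
  ∙     : SCtx k k
  _[∖_] : ∀ {l} → SCtx (suc k) l → Tm k → SCtx k l

data WCtx (k : ℕ) : ℕ → Set where
  ∙      : WCtx k k
  _·ˡ_   : ∀ {l} → WCtx k l → Tm k → WCtx k l
  _·ʳ_   : ∀ {l} → Tm k → WCtx k l → WCtx k l
  _[∖_]ʳ : ∀ {l} → Tm (suc k) → WCtx k l → WCtx k l
  _[∖_]ˡ : ∀ {l} → WCtx (suc k) l → Tm k → WCtx k l

-- _⟨_⟩ˢ and _⟨_⟩ are ordinary (possibly capturing) plugging; the doubled
-- brackets are plugging without capture, where the plugged term lives in the
-- outer scope and is renamed past the binders crossed.

_⟨_⟩ˢ : ∀ {k l} → SCtx k l → Tm l → Tm k
∙          ⟨ t ⟩ˢ = t
(S [∖ u ]) ⟨ t ⟩ˢ = S ⟨ t ⟩ˢ [∖ u ]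

renˢ : ∀ {k l} → SCtx k l → Ren k l
renˢ ∙          = id
renˢ (S [∖ u ]) = renˢ S ∘ suc

_⟨⟨_⟩⟩ˢ : ∀ {k l} → SCtx k l → Tm k → Tm k
S ⟨⟨ t ⟩⟩ˢ = S ⟨ ren (renˢ S) t ⟩ˢ

_⟨_⟩ : ∀ {k l} → WCtx k l → Tm l → Tm k
∙           ⟨ t ⟩ = t
(W ·ˡ u)    ⟨ t ⟩ = W ⟨ t ⟩ · u
(u ·ʳ W)    ⟨ t ⟩ = u · W ⟨ t ⟩
(u [∖ W ]ʳ) ⟨ t ⟩ = u [∖ W ⟨ t ⟩ ]
(W [∖ u ]ˡ) ⟨ t ⟩ = W ⟨ t ⟩ [∖ u ]

renʷ : ∀ {k l} → WCtx k l → Ren k l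
renʷ ∙           = id
renʷ (W ·ˡ u)    = renʷ W
renʷ (u ·ʳ W)    = renʷ W
renʷ (u [∖ W ]ʳ) = renʷ W
renʷ (W [∖ u ]ˡ) = renʷ W ∘ suc

_⟨⟨_⟩⟩ : ∀ {k l} → WCtx k l → Tm k → Tm k
W ⟨⟨ t ⟩⟩ = W ⟨ ren (renʷ W) t ⟩

infix 4 _↦m_ _↦e_ _↦gcv_ _→m_ _→e_ _→gcv_ _→w_

data _↦m_ {k : ℕ} : Rel (Tm k) 0ℓ where
  ↦m : ∀ {l} (S : SCtx k l) (t : Tm (suc l)) (u : Tm k) →
       S ⟨ ƛ t ⟩ˢ · u ↦m S ⟨ t [∖ ren (renˢ S) u ] ⟩ˢ

data _↦e_ {k : ℕ} : Rel (Tm k) 0ℓ where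
  ↦e : ∀ {l} (W : WCtx (suc k) l) (u : Tm k) →
       W ⟨⟨ var zero ⟩⟩ [∖ u ] ↦e W ⟨⟨ weaken u ⟩⟩ [∖ u ]

-- The terms of Tm (suc k) in which index zero is not free are exactly the
-- weaken t with t : Tm k, which expresses the side condition x ∉ fv(t).
data _↦gcv_ {k : ℕ} : Rel (Tm k) 0ℓ where
  ↦gcv : ∀ {l} (t : Tm k) (S : SCtx k l) {v : Tm l} → Value v →
         weaken t [∖ S ⟨ v ⟩ˢ ] ↦gcv S ⟨⟨ t ⟩⟩ˢ

data WeakClosure (R : ∀ {l} → Rel (Tm l) 0ℓ) {k : ℕ} : Rel (Tm k) 0ℓ where
  closure : ∀ {l} (W : WCtx k l) {t u : Tm l} → R t u →
            WeakClosure R (W ⟨ t ⟩) (W ⟨ u ⟩)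

_→m_ _→e_ _→gcv_ _→w_ : ∀ {k} → Rel (Tm k) 0ℓ
_→m_   = WeakClosure _↦m_
_→e_   = WeakClosure _↦e_
_→gcv_ = WeakClosure _↦gcv_
_→w_   = _→m_ ∪ (_→e_ ∪ _→gcv_)

-- Finite multisets are lists considered up to permutation, hereditarily:
-- _≈_ and _≋_ are the equalities of linear and of multi types.

infixr 6 _⊸_
infix 4 _≈_ _≋_ _≋ᶜ_

data Linear : Set where
  𝚗   : Linear
  _⊸_ : List Linear → Linear → Linear

Multi : Set
Multi = List Linear

data _≈_ : Rel Linear 0ℓ where
  𝚗   : 𝚗 ≈ 𝚗
  _⊸_ : ∀ {M M′ L L′} → Permutation _≈_ M M′ → L ≈ L′ → M ⊸ L ≈ M′ ⊸ L′

_≋_ : Rel Multi 0ℓ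
_≋_ = Permutation _≈_

-- For Γ : Ctx (suc k), with x the variable of index zero, Γ(x) is head Γ and
-- Γ \\ x is tail Γ.
Ctx : ℕ → Set
Ctx = Vector Multi

_≋ᶜ_ : ∀ {k} → Rel (Ctx k) 0ℓ
Γ ≋ᶜ Δ = ∀ x → Γ x ≋ Δ x

∅ : ∀ {k} → Ctx k
∅ {k} = replicate k []

infix 5 _∶[_]
_∶[_] : ∀ {k} → Fin k → Linear → Ctx k
x ∶[ L ] = updateAt ∅ x (const [ L ])

infixr 5 _⊎_
_⊎_ : ∀ {k} → Ctx k → Ctx k → Ctx k
_⊎_ = zipWith _++_

⨄ : ∀ {k i} → Vector (Ctx k) i → Ctx k
⨄ = foldr _⊎_ ∅

∑ : ∀ {i} → Vector ℕ i → ℕ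
∑ = foldr _+_ 0

-- The rules conv and convᴹ only identify judgements whose types and contexts
-- are equal as multisets; they leave the term and the indices unchanged.

infix 3 _⊢⟨_,_⟩_∶_ _⊢⟨_,_⟩_∶ᴹ_

data _⊢⟨_,_⟩_∶_ {k : ℕ} : Ctx k → ℕ → ℕ → Tm k → Linear → Set

data _⊢⟨_,_⟩_∶ᴹ_ {k : ℕ} : Ctx k → ℕ → ℕ → Tm k → Multi → Set

data _⊢⟨_,_⟩_∶_ {k} where
  ax   : ∀ {x L} →
         x ∶[ L ] ⊢⟨ 0 , 1 ⟩ var x ∶ L
  axλ  : ∀ {t} →
         ∅ ⊢⟨ 0 , 0 ⟩ ƛ t ∶ 𝚗
  lam  : ∀ {Γ m e t L} →
         Γ ⊢⟨ m , e ⟩ t ∶ L →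
         tail Γ ⊢⟨ m , e ⟩ ƛ t ∶ head Γ ⊸ L
  app  : ∀ {Γ Δ m e m′ e′ t u M L} →
         Γ ⊢⟨ m , e ⟩ t ∶ M ⊸ L →
         Δ ⊢⟨ m′ , e′ ⟩ u ∶ᴹ M ++ [ 𝚗 ] →
         Γ ⊎ Δ ⊢⟨ m + m′ + 1 , e + e′ ⟩ t · u ∶ L
  es   : ∀ {Γ Δ m e m′ e′ t u L} →
         Γ ⊢⟨ m , e ⟩ t ∶ L →
         Δ ⊢⟨ m′ , e′ ⟩ u ∶ᴹ head Γ ++ [ 𝚗 ] →
         tail Γ ⊎ Δ ⊢⟨ m + m′ , e + e′ ⟩ t [∖ u ] ∶ L
  conv : ∀ {Γ Γ′ m e t L L′} → Γ ≋ᶜ Γ′ → L ≈ L′ →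
         Γ ⊢⟨ m , e ⟩ t ∶ L →
         Γ′ ⊢⟨ m , e ⟩ t ∶ L′

data _⊢⟨_,_⟩_∶ᴹ_ {k} where
  many  : ∀ {i t} {Γ : Vector (Ctx k) i} {m e : Vector ℕ i} {L : Vector Linear i} →
          (∀ j → Γ j ⊢⟨ m j , e j ⟩ t ∶ L j) →
          ⨄ Γ ⊢⟨ ∑ m , ∑ e ⟩ t ∶ᴹ toList L
  convᴹ : ∀ {Γ Γ′ m e t M M′} → Γ ≋ᶜ Γ′ → M ≋ M′ →
          Γ ⊢⟨ m , e ⟩ t ∶ᴹ M →
          Γ′ ⊢⟨ m , e ⟩ t ∶ᴹ M′

{-# OPTIONS --safe #-}

-- Every weak normal form n is typable with 𝚗.  Abstractions are typed by axλ,
-- hence a type context for n only needs to be non-empty on variables having an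
-- occurrence in a weak position; in a normal t [∖ u ] the variable bound in t
-- has no such occurrence (it would be an e-redex), so u is only required to
-- have type 𝚗.  An applied normal term is not an answer S ⟨ ƛ t ⟩ˢ (it would be
-- an m-redex), and normal terms that are not answers have every linear type.
-- Typability is then pulled back along the reduction by subject expansion.  For
-- gcv the premise [ 𝚗 ] of the (ES) rule is what types the substitution
-- context S surrounding the erased value.
module Submission where

open import Defs
open import Algebra.Bundles using (CommutativeMonoid)
open import Algebra.Properties.CommutativeSemigroup using (interchange; xy∙z≈xz∙y)
open import Data.Fin.Base using (Fin; zero; suc)
open import Data.Fin.Properties using (_≟_; any?; suc-injective)
open import Data.List.Base using ([]; _∷_; [_]; _++_)
open import Data.List.Relation.Binary.Permutation.Homogeneous using (refl; prep; swap; trans)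
open import Data.List.Relation.Binary.Permutation.Propositional using (_↭_; ↭-refl; ↭-sym; ↭-trans; ↭-reflexive; refl; prep; swap; trans)
open import Data.List.Relation.Binary.Permutation.Propositional.Properties using (++⁺; ++⁺ˡ; ++⁺ʳ; ++-assoc; ++-comm; ++-identityʳ; ++-commutativeMonoid; shifts)
open import Data.List.Relation.Binary.Pointwise.Base using (Pointwise; []; _∷_)
open import Data.Nat.Base using (ℕ; suc)
open import Data.Product.Base using (∃; ∃₂; ∃-syntax; _×_; _,_; proj₂)
open import Data.Sum.Base using (inj₁; inj₂) renaming (_⊎_ to _∨_)
open import Data.Vec.Functional using (Vector; head; tail; updateAt; toList) renaming (_∷_ to _◂_; [] to ⟨⟩)
open import Data.Vec.Functional.Properties using (updateAt-updates; updateAt-minimal)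
open import Function.Base using (_∘_; id; const)
open import Function.Definitions using (Injective)
open import Relation.Binary.Construct.Closure.ReflexiveTransitive using (Star; ε; _◅_)
open import Relation.Binary.PropositionalEquality using (_≡_; _≢_; refl; sym; cong; subst)
open import Relation.Binary.Rewriting using (IsNormalForm)
open import Relation.Nullary using (yes; no; contradiction)

private
  variable
    k k₀ l : ℕ
    Γ Γ′ Δ Θ : Ctx k
    L : Linear
    M N : Multi
    t t′ u : Tm k

  open CommutativeMonoid (++-commutativeMonoid {A = Linear}) using (commutativeSemigroup)

infix 4 _↭ᶜ_
_↭ᶜ_ : Ctx k → Ctx k → Set
Γ ↭ᶜ Δ = ∀ x → Γ x ↭ Δ x

-- A syntax-directed presentation without indices.  Only propositional
-- permutations are needed, since weak reduction never rearranges the multi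
-- types inside a linear type.

infix 3 _⊢_∶_ _⊢_∶ᴹ_

data _⊢_∶_ {k : ℕ} : Ctx k → Tm k → Linear → Set
data _⊢_∶ᴹ_ {k : ℕ} : Ctx k → Tm k → Multi → Set

data _⊢_∶_ {k} where
  ax  : ∀ {Θ x L} → Θ ↭ᶜ x ∶[ L ] → Θ ⊢ var x ∶ L
  axλ : ∀ {Θ t} → Θ ↭ᶜ ∅ → Θ ⊢ ƛ t ∶ 𝚗
  lam : ∀ {Θ t L} (Γ : Ctx (suc k)) → Γ ⊢ t ∶ L → Θ ↭ᶜ tail Γ → Θ ⊢ ƛ t ∶ head Γ ⊸ L
  app : ∀ {Θ t u M L} (Γ Δ : Ctx k) → Γ ⊢ t ∶ M ⊸ L → Δ ⊢ u ∶ᴹ M ++ [ 𝚗 ] →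
        Θ ↭ᶜ Γ ⊎ Δ → Θ ⊢ t · u ∶ L
  es  : ∀ {Θ t u L} (Γ : Ctx (suc k)) (Δ : Ctx k) → Γ ⊢ t ∶ L → Δ ⊢ u ∶ᴹ head Γ ++ [ 𝚗 ] →
        Θ ↭ᶜ tail Γ ⊎ Δ → Θ ⊢ t [∖ u ] ∶ L

data _⊢_∶ᴹ_ {k} where
  none : ∀ {Θ t} → Θ ↭ᶜ ∅ → Θ ⊢ t ∶ᴹ []
  more : ∀ {Θ t L M} (Γ Δ : Ctx k) → Γ ⊢ t ∶ L → Δ ⊢ t ∶ᴹ M →
         Θ ↭ᶜ Γ ⊎ Δ → Θ ⊢ t ∶ᴹ L ∷ M

-- Translation into the indexed system

≈-refl : ∀ L → L ≈ L
≋-refl : ∀ M → Pointwise _≈_ M M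
≈-refl 𝚗       = 𝚗
≈-refl (M ⊸ L) = refl (≋-refl M) ⊸ ≈-refl L
≋-refl []      = []
≋-refl (L ∷ M) = ≈-refl L ∷ ≋-refl M

↭⇒≋ : M ↭ N → M ≋ N
↭⇒≋ refl         = refl (≋-refl _)
↭⇒≋ (prep L p)   = prep (≈-refl L) (↭⇒≋ p)
↭⇒≋ (swap K L p) = swap (≈-refl K) (≈-refl L) (↭⇒≋ p)
↭⇒≋ (trans p q)  = trans (↭⇒≋ p) (↭⇒≋ q)

↭ᶜ⇒≋ᶜ : Γ ↭ᶜ Δ → Δ ≋ᶜ Γ
↭ᶜ⇒≋ᶜ p x = ↭⇒≋ (↭-sym (p x))

Derivable : Ctx k → Tm k → Linear → Set
Derivable Γ t L = ∃₂ λ m e → Γ ⊢⟨ m , e ⟩ t ∶ L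

-- The premises of a single `many`, left unpacked so that one more derivation can be put in front of
-- them.
DerivableFamily : Ctx k → Tm k → Multi → Set
DerivableFamily Θ t M =
  ∃ λ i → ∃₂ λ (Γs : Vector (Ctx _) i) (Ls : Vector Linear i) →
    (∀ j → Derivable (Γs j) t (Ls j)) × Θ ↭ᶜ ⨄ Γs × toList Ls ≡ M

many-derivable : DerivableFamily Γ t M → ∃₂ λ m e → Γ ⊢⟨ m , e ⟩ t ∶ᴹ M
many-derivable (_ , _ , _ , ds , p , refl) =
  _ , _ , convᴹ (↭ᶜ⇒≋ᶜ p) (refl (≋-refl _)) (many (λ j → proj₂ (proj₂ (ds j))))

derivable  : Γ ⊢ t ∶ L → Derivable Γ t L
derivableᴹ : Γ ⊢ t ∶ᴹ M → DerivableFamily Γ t M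

derivable (ax p)    = _ , _ , conv (↭ᶜ⇒≋ᶜ p) (≈-refl _) ax
derivable (axλ p)   = _ , _ , conv (↭ᶜ⇒≋ᶜ p) (≈-refl _) axλ
derivable (lam Γ d p) with _ , _ , d′ ← derivable d =
  _ , _ , conv (↭ᶜ⇒≋ᶜ p) (≈-refl _) (lam d′)
derivable (app Γ Δ d ds p)
  with _ , _ , d′ ← derivable d | _ , _ , ds′ ← many-derivable (derivableᴹ ds) =
  _ , _ , conv (↭ᶜ⇒≋ᶜ p) (≈-refl _) (app d′ ds′)
derivable (es Γ Δ d ds p)
  with _ , _ , d′ ← derivable d | _ , _ , ds′ ← many-derivable (derivableᴹ ds) =
  _ , _ , conv (↭ᶜ⇒≋ᶜ p) (≈-refl _) (es d′ ds′)

derivableᴹ (none p) = 0 , ⟨⟩ , ⟨⟩ , (λ ()) , p , refl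
derivableᴹ (more {L = L} Γ Δ d ds p) with i , Γs , Ls , f , q , refl ← derivableᴹ ds =
  suc i , Γ ◂ Γs , L ◂ Ls ,
  (λ { zero → derivable d ; (suc j) → f j }) ,
  (λ x → ↭-trans (p x) (++⁺ˡ (Γ x) (q x))) , refl

-- Structural lemmas

-- Every rule already ends with a permutation of its context, so the new one is composed with that
-- of the last rule.
cast : Γ ↭ᶜ Δ → Δ ⊢ t ∶ L → Γ ⊢ t ∶ L
cast p (ax q)          = ax (λ x → ↭-trans (p x) (q x))
cast p (axλ q)         = axλ (λ x → ↭-trans (p x) (q x))
cast p (lam Γ d q)     = lam Γ d (λ x → ↭-trans (p x) (q x))
cast p (app Γ Δ d e q) = app Γ Δ d e (λ x → ↭-trans (p x) (q x))
cast p (es Γ Δ d e q)  = es Γ Δ d e (λ x → ↭-trans (p x) (q x))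

permuteᴹ : M ↭ N → Γ ⊢ t ∶ᴹ M → Γ ⊢ t ∶ᴹ N
permuteᴹ refl        ds                = ds
permuteᴹ (prep _ p)  (more Γ Δ d ds q) = more Γ Δ d (permuteᴹ p ds) q
permuteᴹ (trans p q) ds                = permuteᴹ q (permuteᴹ p ds)
permuteᴹ (swap _ _ p) (more Γ₁ Δ d₁ (more Γ₂ Δ′ d₂ ds q₂) q₁) =
  more Γ₂ (Γ₁ ⊎ Δ′) d₂ (more Γ₁ Δ′ d₁ (permuteᴹ p ds) (λ _ → ↭-refl))
    (λ x → ↭-trans (q₁ x) (↭-trans (++⁺ˡ (Γ₁ x) (q₂ x)) (shifts (Γ₁ x) (Γ₂ x))))

castᴹ : Γ ↭ᶜ Δ → Δ ⊢ t ∶ᴹ M → Γ ⊢ t ∶ᴹ M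
castᴹ p (none q)          = none (λ x → ↭-trans (p x) (q x))
castᴹ p (more Γ Δ d ds q) = more Γ Δ d ds (λ x → ↭-trans (p x) (q x))

concatᴹ : Γ ⊢ t ∶ᴹ M → Δ ⊢ t ∶ᴹ N → Γ ⊎ Δ ⊢ t ∶ᴹ M ++ N
concatᴹ {Δ = Δ} (none p) ds′ = castᴹ (λ x → ++⁺ʳ (Δ x) (p x)) ds′
concatᴹ {Δ = Δ} (more Γ₁ Γ₂ d ds p) ds′ =
  more Γ₁ (Γ₂ ⊎ Δ) d (concatᴹ ds ds′)
    (λ x → ↭-trans (++⁺ʳ (Δ x) (p x)) (++-assoc (Γ₁ x) (Γ₂ x) (Δ x)))

singletonᴹ : Γ ⊢ t ∶ L → Γ ⊢ t ∶ᴹ [ L ]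
singletonᴹ {Γ = Γ} d = more Γ ∅ d (none (λ _ → ↭-refl)) (λ x → ↭-sym (++-identityʳ (Γ x)))

-- Inclusion of typings and weak contexts

infix 4 _≼_
_≼_ : Tm k → Tm k → Set
t ≼ t′ = ∀ {Γ L} → Γ ⊢ t ∶ L → Γ ⊢ t′ ∶ L

≼-many : t ≼ t′ → Γ ⊢ t ∶ᴹ M → Γ ⊢ t′ ∶ᴹ M
≼-many f (none p)          = none p
≼-many f (more Γ Δ d ds p) = more Γ Δ (f d) (≼-many f ds) p

≼-weak : (W : WCtx k l) → t ≼ t′ → W ⟨ t ⟩ ≼ W ⟨ t′ ⟩
≼-weak ∙           f d                = f d
≼-weak (W ·ˡ u)    f (app Γ Δ d ds p) = app Γ Δ (≼-weak W f d) ds p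
≼-weak (u ·ʳ W)    f (app Γ Δ d ds p) = app Γ Δ d (≼-many (≼-weak W f) ds) p
≼-weak (u [∖ W ]ʳ) f (es Γ Δ d ds p)  = es Γ Δ d (≼-many (≼-weak W f) ds) p
≼-weak (W [∖ u ]ˡ) f (es Γ Δ d ds p)  = es Γ Δ (≼-weak W f d) ds p

-- Context arithmetic

⊎-splitˡ : (Γ₁ Γ₂ : Ctx k) → Θ ↭ᶜ Γ ⊎ Δ → Γ ↭ᶜ Γ₁ ⊎ Γ₂ → Θ ↭ᶜ (Γ₁ ⊎ Δ) ⊎ Γ₂
⊎-splitˡ {Δ = Δ} Γ₁ Γ₂ p q x =
  ↭-trans (p x) (↭-trans (++⁺ʳ (Δ x) (q x)) (xy∙z≈xz∙y commutativeSemigroup (Γ₁ x) (Γ₂ x) (Δ x)))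

⊎-splitʳ : (Δ₁ Δ₂ : Ctx k) → Θ ↭ᶜ Γ ⊎ Δ → Δ ↭ᶜ Δ₁ ⊎ Δ₂ → Θ ↭ᶜ (Γ ⊎ Δ₁) ⊎ Δ₂
⊎-splitʳ {Γ = Γ} Δ₁ Δ₂ p q x =
  ↭-trans (p x) (↭-trans (++⁺ˡ (Γ x) (q x)) (↭-sym (++-assoc (Γ x) (Δ₁ x) (Δ₂ x))))

⊎-swapʳ : (Γ Δ Θ : Ctx k) → (Γ ⊎ Δ) ⊎ Θ ↭ᶜ (Γ ⊎ Θ) ⊎ Δ
⊎-swapʳ Γ Δ Θ x = xy∙z≈xz∙y commutativeSemigroup (Γ x) (Δ x) (Θ x)

infix 6 _∶ᴹ[_]
-- Extends `x ∶[ L ]` from one occurrence of `x` to a whole multiset of them, possibly empty.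
_∶ᴹ[_] : Fin k → Multi → Ctx k
x ∶ᴹ[ M ] = updateAt ∅ x (const M)

∶ᴹ-at : (x : Fin k) → (x ∶ᴹ[ M ]) x ≡ M
∶ᴹ-at x = updateAt-updates x ∅

∶ᴹ-away : (x y : Fin k) → y ≢ x → (x ∶ᴹ[ M ]) y ≡ []
∶ᴹ-away x y y≢x = updateAt-minimal y x ∅ y≢x

∶ᴹ-[] : (x : Fin k) → ∅ ↭ᶜ x ∶ᴹ[ [] ]
∶ᴹ-[] zero    zero    = ↭-refl
∶ᴹ-[] zero    (suc y) = ↭-refl
∶ᴹ-[] (suc x) zero    = ↭-refl
∶ᴹ-[] (suc x) (suc y) = ∶ᴹ-[] x y

∶ᴹ-++ : (x : Fin k) → x ∶ᴹ[ M ++ N ] ↭ᶜ x ∶ᴹ[ M ] ⊎ x ∶ᴹ[ N ]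
∶ᴹ-++ zero    zero    = ↭-refl
∶ᴹ-++ zero    (suc y) = ↭-refl
∶ᴹ-++ (suc x) zero    = ↭-refl
∶ᴹ-++ (suc x) (suc y) = ∶ᴹ-++ x y

-- Renaming

-- For `ρ = renˢ S` this says that no variable bound by `S` is used.
EmptyOutside : Ren k l → Ctx l → Set
EmptyOutside ρ Γ = ∀ y → (∀ x → ρ x ≢ y) → Γ y ↭ []

EmptyOutside-⊎ : {ρ : Ren k l} → EmptyOutside ρ Γ → EmptyOutside ρ Δ → EmptyOutside ρ (Γ ⊎ Δ)
EmptyOutside-⊎ p q y y∉ρ = ++⁺ (p y y∉ρ) (q y y∉ρ)

EmptyOutside-cast : {ρ : Ren k l} → Γ ↭ᶜ Δ → EmptyOutside ρ Δ → EmptyOutside ρ Γ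
EmptyOutside-cast p q y y∉ρ = ↭-trans (p y) (q y y∉ρ)

EmptyOutside-tail : {ρ : Ren k l} → EmptyOutside (liftRen ρ) Γ → EmptyOutside ρ (tail Γ)
EmptyOutside-tail {ρ = ρ} p y y∉ρ = p (suc y) λ { (suc x) eq → y∉ρ x (suc-injective eq) }

EmptyOutside-suc : {ρ : Ren k l} → EmptyOutside (suc ∘ ρ) Γ → EmptyOutside ρ (tail Γ)
EmptyOutside-suc p y y∉ρ = p (suc y) λ x → y∉ρ x ∘ suc-injective

liftRen-injective : {ρ : Ren k l} → Injective _≡_ _≡_ ρ → Injective _≡_ _≡_ (liftRen ρ)
liftRen-injective inj {zero}  {zero}  eq = refl
liftRen-injective inj {suc x} {suc y} eq = cong suc (inj (suc-injective eq))

renˢ-injective : (S : SCtx k l) → Injective _≡_ _≡_ (renˢ S)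
renˢ-injective ∙          eq = eq
renˢ-injective (S [∖ u ]) eq = suc-injective (renˢ-injective S eq)

-- A relation rather than a function, because contexts matter only up to permutation; `push` gives
-- existence and `Pushforward-unique` uniqueness.
Pushforward : Ren k l → Ctx k → Ctx l → Set
Pushforward ρ Γ Δ = Δ ∘ ρ ↭ᶜ Γ × EmptyOutside ρ Δ

-- Membership in the image of `ρ` is decidable on `Fin`, and injectivity makes the preimage found by
-- the search the right one.
push : (ρ : Ren k l) → Injective _≡_ _≡_ ρ → (Γ : Ctx k) → ∃ (Pushforward ρ Γ)
push {k} {l} ρ inj Γ = ρΓ , inside , outside
  where
  ρΓ : Ctx l
  ρΓ y with any? (λ x → ρ x ≟ y)
  ... | yes (x , _) = Γ x
  ... | no _        = []
  inside : ρΓ ∘ ρ ↭ᶜ Γ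
  inside x with any? (λ x′ → ρ x′ ≟ ρ x)
  ... | yes (x′ , eq) = ↭-reflexive (cong Γ (inj eq))
  ... | no ρx∉ρ       = contradiction (x , refl) ρx∉ρ
  outside : EmptyOutside ρ ρΓ
  outside y y∉ρ with any? (λ x → ρ x ≟ y)
  ... | yes (x , eq) = contradiction eq (y∉ρ x)
  ... | no _         = ↭-refl

Pushforward-lift : {ρ : Ren k l} {Γ : Ctx (suc k)} →
                   Pushforward ρ (tail Γ) Δ → Pushforward (liftRen ρ) Γ (head Γ ◂ Δ)
Pushforward-lift (p , q) =
  (λ { zero → ↭-refl ; (suc x) → p x }) ,
  (λ { zero y∉ρ → contradiction refl (y∉ρ zero)
     ; (suc y) y∉ρ → q y (λ x → y∉ρ (suc x) ∘ cong suc) })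

Pushforward-cast : {ρ : Ren k l} → Γ ↭ᶜ Γ′ → Pushforward ρ Γ Δ → Pushforward ρ Γ′ Δ
Pushforward-cast p (q , v) = (λ x → ↭-trans (q x) (p x)) , v

Pushforward-∅ : {ρ : Ren k l} → Pushforward ρ ∅ (∅ {l})
Pushforward-∅ = (λ _ → ↭-refl) , (λ _ _ → ↭-refl)

Pushforward-⊎ : {ρ : Ren k l} {Γ₁ Γ₂ : Ctx k} {Δ₁ Δ₂ : Ctx l} → Pushforward ρ Γ₁ Δ₁ →
                Pushforward ρ Γ₂ Δ₂ → Pushforward ρ (Γ₁ ⊎ Γ₂) (Δ₁ ⊎ Δ₂)
Pushforward-⊎ (p₁ , v₁) (p₂ , v₂) = (λ x → ++⁺ (p₁ x) (p₂ x)) , EmptyOutside-⊎ v₁ v₂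

Pushforward-unique : {ρ : Ren k l} {Δ Δ′ : Ctx l} →
                     Pushforward ρ Γ Δ → Pushforward ρ Γ Δ′ → Δ ↭ᶜ Δ′
Pushforward-unique {ρ = ρ} (p , v) (q , w) y with any? (λ x → ρ x ≟ y)
... | yes (x , refl) = ↭-trans (p x) (↭-sym (q x))
... | no y∉ρ         = ↭-trans (v y λ x eq → y∉ρ (x , eq)) (↭-sym (w y λ x eq → y∉ρ (x , eq)))

Pushforward-∶ᴹ : {ρ : Ren k l} → Injective _≡_ _≡_ ρ → (x : Fin k) →
                 Pushforward ρ (x ∶ᴹ[ M ]) (ρ x ∶ᴹ[ M ])
Pushforward-∶ᴹ {M = M} {ρ = ρ} inj x = inside , outside
  where
  inside : (ρ x ∶ᴹ[ M ]) ∘ ρ ↭ᶜ x ∶ᴹ[ M ]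
  inside y with y ≟ x
  ... | yes refl = ↭-trans (↭-reflexive (∶ᴹ-at (ρ x))) (↭-reflexive (sym (∶ᴹ-at x)))
  ... | no y≢x   = ↭-trans (↭-reflexive (∶ᴹ-away (ρ x) (ρ y) (y≢x ∘ inj)))
                           (↭-reflexive (sym (∶ᴹ-away x y y≢x)))
  outside : EmptyOutside ρ (ρ x ∶ᴹ[ M ])
  outside y y∉ρ = ↭-reflexive (∶ᴹ-away (ρ x) y (y∉ρ x ∘ sym))

-- The system has no weakening: a context records only actual uses, so variables outside the image
-- of `ρ` receive the empty multi type.
unrename : (ρ : Ren k l) → Injective _≡_ _≡_ ρ → (t : Tm k) →
           Γ ⊢ ren ρ t ∶ L → EmptyOutside ρ Γ × (Γ ∘ ρ ⊢ t ∶ L)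
unrenameᴹ : (ρ : Ren k l) → Injective _≡_ _≡_ ρ → (t : Tm k) →
            Γ ⊢ ren ρ t ∶ᴹ M → EmptyOutside ρ Γ × (Γ ∘ ρ ⊢ t ∶ᴹ M)

unrename ρ inj (var x) (ax p) with q , v ← Pushforward-∶ᴹ inj x =
  EmptyOutside-cast p v , ax (λ y → ↭-trans (p (ρ y)) (q y))
unrename ρ inj (ƛ t) (axλ p) = (λ y _ → p y) , axλ (p ∘ ρ)
unrename ρ inj (ƛ t) (lam Γ d p) with v , d′ ← unrename (liftRen ρ) (liftRen-injective inj) t d =
  EmptyOutside-cast p (EmptyOutside-tail v) , lam (Γ ∘ liftRen ρ) d′ (p ∘ ρ)
unrename ρ inj (t · u) (app Γ Δ d ds p)
  with v , d′ ← unrename ρ inj t d | w , ds′ ← unrenameᴹ ρ inj u ds =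
  EmptyOutside-cast p (EmptyOutside-⊎ v w) , app (Γ ∘ ρ) (Δ ∘ ρ) d′ ds′ (p ∘ ρ)
unrename ρ inj (t [∖ u ]) (es Γ Δ d ds p)
  with v , d′ ← unrename (liftRen ρ) (liftRen-injective inj) t d | w , ds′ ← unrenameᴹ ρ inj u ds =
  EmptyOutside-cast p (EmptyOutside-⊎ (EmptyOutside-tail v) w) ,
  es (Γ ∘ liftRen ρ) (Δ ∘ ρ) d′ ds′ (p ∘ ρ)

unrenameᴹ ρ inj t (none p) = (λ y _ → p y) , none (p ∘ ρ)
unrenameᴹ ρ inj t (more Γ Δ d ds p)
  with v , d′ ← unrename ρ inj t d | w , ds′ ← unrenameᴹ ρ inj t ds =
  EmptyOutside-cast p (EmptyOutside-⊎ v w) , more (Γ ∘ ρ) (Δ ∘ ρ) d′ ds′ (p ∘ ρ)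

-- In the branching rules each summand of the context is pushed forward separately; uniqueness
-- identifies the sum of the results with `Δ`.
rename : (ρ : Ren k l) → Injective _≡_ _≡_ ρ → Pushforward ρ Γ Δ →
         Γ ⊢ t ∶ L → Δ ⊢ ren ρ t ∶ L
renameᴹ : (ρ : Ren k l) → Injective _≡_ _≡_ ρ → Pushforward ρ Γ Δ →
          Γ ⊢ t ∶ᴹ M → Δ ⊢ ren ρ t ∶ᴹ M

rename ρ inj r (ax p) = ax (Pushforward-unique (Pushforward-cast p r) (Pushforward-∶ᴹ inj _))
rename ρ inj r (axλ p) = axλ (Pushforward-unique (Pushforward-cast p r) Pushforward-∅)
rename {Δ = Δ} ρ inj r (lam Γ d p) =
  lam (head Γ ◂ Δ)
    (rename (liftRen ρ) (liftRen-injective inj) (Pushforward-lift (Pushforward-cast p r)) d)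
    (λ _ → ↭-refl)
rename ρ inj r (app Γ₁ Γ₂ d ds p) with Δ₁ , r₁ ← push ρ inj Γ₁ | Δ₂ , r₂ ← push ρ inj Γ₂ =
  app Δ₁ Δ₂ (rename ρ inj r₁ d) (renameᴹ ρ inj r₂ ds)
    (Pushforward-unique (Pushforward-cast p r) (Pushforward-⊎ r₁ r₂))
rename ρ inj r (es Γ₁ Γ₂ d ds p) with Δ₁ , r₁ ← push ρ inj (tail Γ₁) | Δ₂ , r₂ ← push ρ inj Γ₂ =
  es (head Γ₁ ◂ Δ₁) Δ₂
    (rename (liftRen ρ) (liftRen-injective inj) (Pushforward-lift r₁) d) (renameᴹ ρ inj r₂ ds)
    (Pushforward-unique (Pushforward-cast p r) (Pushforward-⊎ r₁ r₂))

renameᴹ ρ inj r (none p) = none (Pushforward-unique (Pushforward-cast p r) Pushforward-∅)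
renameᴹ ρ inj r (more Γ₁ Γ₂ d ds p) with Δ₁ , r₁ ← push ρ inj Γ₁ | Δ₂ , r₂ ← push ρ inj Γ₂ =
  more Δ₁ Δ₂ (rename ρ inj r₁ d) (renameᴹ ρ inj r₂ ds)
    (Pushforward-unique (Pushforward-cast p r) (Pushforward-⊎ r₁ r₂))

weaken-typing : Γ ⊢ t ∶ L → [] ◂ Γ ⊢ weaken t ∶ L
weaken-typing = rename suc suc-injective
  ((λ _ → ↭-refl) , λ { zero _ → ↭-refl ; (suc y) y∉ → contradiction refl (y∉ y) })

-- Subject expansion for m and gcv

-- Γ₂ mentions only variables visible outside the substitution context being
-- crossed, so it can be moved out of that context.
Split : Ren k₀ k → (Linear → Ctx k₀ → Set) → Tm k → Ctx k → Set
Split {k = k} ρ P t Γ = ∃₂ λ (Γ₁ Γ₂ : Ctx k) → ∃ λ L →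
  Γ ↭ᶜ Γ₁ ⊎ Γ₂ × EmptyOutside ρ Γ₂ × (Γ₁ ⊢ t ∶ L) × P L (Γ₂ ∘ ρ)

-- Index zero is not in the image of `suc ∘ ρ`, so `Γ₂` contributes nothing to the type of the bound
-- variable.
split-head : {ρ : Ren k₀ k} {Γ Γ₁ Γ₂ : Ctx (suc k)} → Γ ↭ᶜ Γ₁ ⊎ Γ₂ →
             EmptyOutside (suc ∘ ρ) Γ₂ → head Γ ↭ head Γ₁
split-head {Γ₁ = Γ₁} p v =
  ↭-trans (p zero) (↭-trans (++⁺ˡ (Γ₁ zero) (v zero λ _ ())) (++-identityʳ (Γ₁ zero)))

-- Each substitution of `S` stays with the hole, while `Γ₂` leaves its scope. As `P` speaks only of
-- the fixed scope `k₀`, it survives every step unchanged; one induction thus serves both m and gcv.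
split-SCtx : (S : SCtx k l) (ρ : Ren k₀ k) (P : Linear → Ctx k₀ → Set) →
             (∀ {Γ} → Γ ⊢ t ∶ L → Split (renˢ S ∘ ρ) P t′ Γ) →
             Γ ⊢ S ⟨ t ⟩ˢ ∶ L → Split ρ P (S ⟨ t′ ⟩ˢ) Γ
split-SCtx ∙          ρ P f d = f d
split-SCtx (S [∖ u ]) ρ P f (es Γ Δ d ds p)
  with Γ₁ , Γ₂ , L , q , v , d′ , r ← split-SCtx S (suc ∘ ρ) P f d =
  tail Γ₁ ⊎ Δ , tail Γ₂ , L , ⊎-splitˡ (tail Γ₁) (tail Γ₂) p (q ∘ suc) , EmptyOutside-suc v ,
  es Γ₁ Δ d′ (permuteᴹ (++⁺ʳ [ 𝚗 ] (split-head q v)) ds) (λ _ → ↭-refl) , r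

TypesArgument : Tm k → Linear → Linear → Ctx k → Set
TypesArgument u L K Δ = ∃ λ M → K ≡ M ⊸ L × (Δ ⊢ u ∶ᴹ M ++ [ 𝚗 ])

-- The rules `es` and `app` ask the same of `u`: its type `head Γ ++ [ 𝚗 ]` is what an application
-- of a term of type `head Γ ⊸ L` needs.
split-m : (S : SCtx k l) (t : Tm (suc l)) (u : Tm k) →
          Γ ⊢ S ⟨ t [∖ ren (renˢ S) u ] ⟩ˢ ∶ L →
          Split id (TypesArgument u L) (S ⟨ ƛ t ⟩ˢ) Γ
split-m {L = L} S t u = split-SCtx S id (TypesArgument u L) hole
  where
  hole : ∀ {Γ} → Γ ⊢ t [∖ ren (renˢ S) u ] ∶ L → Split (renˢ S) (TypesArgument u L) (ƛ t) Γ
  hole (es Γ Δ d ds p) with v , ds′ ← unrenameᴹ (renˢ S) (renˢ-injective S) u ds =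
    tail Γ , Δ , head Γ ⊸ L , p , v , lam Γ d (λ _ → ↭-refl) , head Γ , refl , ds′

m-expansion : _↦m_ t t′ → t′ ≼ t
m-expansion (↦m S t u) d with Γ₁ , Γ₂ , _ , p , _ , d′ , _ , refl , ds ← split-m S t u d =
  app Γ₁ Γ₂ d′ ds p

TypesBody : Tm k → Linear → Linear → Ctx k → Set
TypesBody t L K Δ = K ≡ 𝚗 × (Δ ⊢ t ∶ L)

split-gcv : (t : Tm k) (S : SCtx k l) (b : Tm (suc l)) → Γ ⊢ S ⟨⟨ t ⟩⟩ˢ ∶ L →
            Split id (TypesBody t L) (S ⟨ ƛ b ⟩ˢ) Γ
split-gcv {L = L} t S b = split-SCtx S id (TypesBody t L) hole
  where
  hole : ∀ {Γ} → Γ ⊢ ren (renˢ S) t ∶ L → Split (renˢ S) (TypesBody t L) (ƛ b) Γ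
  hole {Γ} d with v , d′ ← unrename (renˢ S) (renˢ-injective S) t d =
    -- The value is typed by `axλ` and uses nothing, so all of the context at the hole goes to `t`.
    ∅ , Γ , 𝚗 , (λ _ → ↭-refl) , v , axλ (λ _ → ↭-refl) , refl , d′

gcv-expansion : _↦gcv_ t t′ → t′ ≼ t
gcv-expansion (↦gcv t S (ƛ b)) d with Γ₁ , Γ₂ , _ , p , _ , d′ , refl , e ← split-gcv t S b d =
  -- The erased variable has the empty multi type, so the argument has to be typed only with
  -- `[ 𝚗 ]`.
  es ([] ◂ Γ₂) Γ₁ (weaken-typing e) (singletonᴹ d′)
    (λ x → ↭-trans (p x) (++-comm (Γ₁ x) (Γ₂ x)))

-- Subject expansion for e

-- The types of the occurrence of u are collected into a multi type, since a
-- weak context may type its hole any number of times.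
Extraction : Ren k₀ k → Tm k₀ → Fin k → (Ctx k → Set) → Ctx k → Set
Extraction {k = k} ρ u x J Γ = ∃₂ λ (Γ₁ Γ₂ : Ctx k) → ∃ λ M →
  Γ ↭ᶜ Γ₁ ⊎ Γ₂ × EmptyOutside ρ Γ₂ × (Γ₂ ∘ ρ ⊢ u ∶ᴹ M) × J (Γ₁ ⊎ x ∶ᴹ[ M ])

extract-many : {ρ : Ren k₀ k} {x : Fin k} →
               (∀ {Γ L} → Γ ⊢ t ∶ L → Extraction ρ u x (_⊢ t′ ∶ L) Γ) →
               Γ ⊢ t ∶ᴹ M → Extraction ρ u x (_⊢ t′ ∶ᴹ M) Γ
extract-many {x = x} f (none p) =
  ∅ , ∅ , [] , p , (λ _ _ → ↭-refl) , none (λ _ → ↭-refl) , none (λ y → ↭-sym (∶ᴹ-[] x y))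
extract-many {x = x} f (more Γ Δ d ds p)
  with Γ₁ , Γ₂ , M , q , v , e , d′ ← f d
     | Δ₁ , Δ₂ , N , r , w , es′ , ds′ ← extract-many f ds =
  Γ₁ ⊎ Δ₁ , Γ₂ ⊎ Δ₂ , M ++ N ,
  (λ y → ↭-trans (p y) (↭-trans (++⁺ (q y) (r y))
           (interchange commutativeSemigroup (Γ₁ y) (Γ₂ y) (Δ₁ y) (Δ₂ y)))) ,
  EmptyOutside-⊎ v w , concatᴹ e es′ ,
  more (Γ₁ ⊎ x ∶ᴹ[ M ]) (Δ₁ ⊎ x ∶ᴹ[ N ]) d′ ds′
    (λ y → ↭-trans (++⁺ˡ (Γ₁ y ++ Δ₁ y) (∶ᴹ-++ x y))
             (interchange commutativeSemigroup (Γ₁ y) (Δ₁ y) _ _))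

-- The scope of `u` stays fixed as `W` is traversed; crossing a binder turns `ρ` and `x` into
-- `suc ∘ ρ` and `suc x`, which is why both are general.
extract : (W : WCtx k l) (ρ : Ren k₀ k) → Injective _≡_ _≡_ ρ → (u : Tm k₀) (x : Fin k) →
          Γ ⊢ W ⟨ ren (renʷ W ∘ ρ) u ⟩ ∶ L →
          Extraction ρ u x (_⊢ W ⟨ var (renʷ W x) ⟩ ∶ L) Γ
extract {Γ = Γ} {L = L} ∙ ρ inj u x d with v , d′ ← unrename ρ inj u d =
  -- This copy of `u` is typed once, with `L`; the variable replacing it has the axiom context
  -- `x ∶[ L ]`.
  ∅ , Γ , [ L ] , (λ _ → ↭-refl) , v , singletonᴹ d′ , ax (λ _ → ↭-refl)
extract (W ·ˡ s) ρ inj u x (app Γ Δ d ds p)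
  with Γ₁ , Γ₂ , M , q , v , e , d′ ← extract W ρ inj u x d =
  Γ₁ ⊎ Δ , Γ₂ , M , ⊎-splitˡ Γ₁ Γ₂ p q , v , e ,
  app (Γ₁ ⊎ x ∶ᴹ[ M ]) Δ d′ ds (⊎-swapʳ Γ₁ Δ (x ∶ᴹ[ M ]))
extract (s ·ʳ W) ρ inj u x (app Γ Δ d ds p)
  with Δ₁ , Δ₂ , M , q , v , e , ds′ ← extract-many (extract W ρ inj u x) ds =
  Γ ⊎ Δ₁ , Δ₂ , M , ⊎-splitʳ Δ₁ Δ₂ p q , v , e ,
  app Γ (Δ₁ ⊎ x ∶ᴹ[ M ]) d ds′ (λ y → ++-assoc (Γ y) (Δ₁ y) _)
extract (s [∖ W ]ʳ) ρ inj u x (es Γ Δ d ds p)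
  with Δ₁ , Δ₂ , M , q , v , e , ds′ ← extract-many (extract W ρ inj u x) ds =
  tail Γ ⊎ Δ₁ , Δ₂ , M , ⊎-splitʳ Δ₁ Δ₂ p q , v , e ,
  es Γ (Δ₁ ⊎ x ∶ᴹ[ M ]) d ds′ (λ y → ++-assoc (Γ (suc y)) (Δ₁ y) _)
extract (W [∖ s ]ˡ) ρ inj u x (es Γ Δ d ds p)
  with Γ₁ , Γ₂ , M , q , v , e , d′ ← extract W (suc ∘ ρ) (inj ∘ suc-injective) u (suc x) d =
  tail Γ₁ ⊎ Δ , tail Γ₂ , M , ⊎-splitˡ (tail Γ₁) (tail Γ₂) p (q ∘ suc) , EmptyOutside-suc v , e ,
  es (Γ₁ ⊎ suc x ∶ᴹ[ M ]) Δ d′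
    -- Neither `Γ₂` nor `suc x ∶ᴹ[ M ]` has anything at index zero, so `s` keeps its multi type.
    (permuteᴹ (++⁺ʳ [ 𝚗 ] (↭-trans (split-head q v) (↭-sym (++-identityʳ (Γ₁ zero))))) ds)
    (⊎-swapʳ (tail Γ₁) Δ (x ∶ᴹ[ M ]))

-- The types `M` at which the copy of `u` was used become types of the bound variable, and the
-- derivations of that copy join those of the argument.
e-expansion : _↦e_ t t′ → t′ ≼ t
e-expansion (↦e W u) (es Γ Δ d ds p)
  with Γ₁ , Γ₂ , M , q , _ , e , d′ ← extract W id id (weaken u) zero d
  -- The copy is `weaken u`, so its context is empty at the bound variable and its tail types `u`
  -- outside the substitution.
  with v , e′ ← unrenameᴹ suc suc-injective u e =
  es (Γ₁ ⊎ zero ∶ᴹ[ M ]) (Δ ⊎ tail Γ₂) d′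
    (permuteᴹ multi-eq (concatᴹ ds e′))
    (λ x → ↭-trans (⊎-splitˡ (tail Γ₁) (tail Γ₂) p (q ∘ suc) x)
             (↭-trans (++-assoc (Γ₁ (suc x)) (Δ x) (Γ₂ (suc x)))
                (++⁺ʳ _ (↭-sym (++-identityʳ (Γ₁ (suc x)))))))
  where
  multi-eq : (head Γ ++ [ 𝚗 ]) ++ M ↭ (head Γ₁ ++ M) ++ [ 𝚗 ]
  multi-eq = ↭-trans (xy∙z≈xz∙y commutativeSemigroup (head Γ) [ 𝚗 ] M)
               (++⁺ʳ [ 𝚗 ] (++⁺ʳ M (split-head {ρ = id} q v)))

subject-expansion : t →w t′ → t′ ≼ t
subject-expansion (inj₁ (closure W r))        = ≼-weak W (m-expansion r)
subject-expansion (inj₂ (inj₁ (closure W r))) = ≼-weak W (e-expansion r)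
subject-expansion (inj₂ (inj₂ (closure W r))) = ≼-weak W (gcv-expansion r)

-- Normal forms

_∘ʷ_ : ∀ {j} → WCtx k l → WCtx l j → WCtx k j
∙           ∘ʷ V = V
(W ·ˡ u)    ∘ʷ V = (W ∘ʷ V) ·ˡ u
(u ·ʳ W)    ∘ʷ V = u ·ʳ (W ∘ʷ V)
(u [∖ W ]ʳ) ∘ʷ V = u [∖ W ∘ʷ V ]ʳ
(W [∖ u ]ˡ) ∘ʷ V = (W ∘ʷ V) [∖ u ]ˡ

∘ʷ-plug : ∀ {j} (W : WCtx k l) (V : WCtx l j) (t : Tm j) → (W ∘ʷ V) ⟨ t ⟩ ≡ W ⟨ V ⟨ t ⟩ ⟩
∘ʷ-plug ∙           V t = refl
∘ʷ-plug (W ·ˡ u)    V t = cong (_· u) (∘ʷ-plug W V t)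
∘ʷ-plug (u ·ʳ W)    V t = cong (u ·_) (∘ʷ-plug W V t)
∘ʷ-plug (u [∖ W ]ʳ) V t = cong (u [∖_]) (∘ʷ-plug W V t)
∘ʷ-plug (W [∖ u ]ˡ) V t = cong (_[∖ u ]) (∘ʷ-plug W V t)

WeakClosure-weak : {R : ∀ {j} → Tm j → Tm j → Set} (W : WCtx k l) →
                   WeakClosure R t t′ → WeakClosure R (W ⟨ t ⟩) (W ⟨ t′ ⟩)
WeakClosure-weak W (closure V {t} {t′} r)
  rewrite sym (∘ʷ-plug W V t) | sym (∘ʷ-plug W V t′) = closure (W ∘ʷ V) r

→w-weak : (W : WCtx k l) → t →w t′ → W ⟨ t ⟩ →w W ⟨ t′ ⟩
→w-weak W (inj₁ r)        = inj₁ (WeakClosure-weak W r)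
→w-weak W (inj₂ (inj₁ r)) = inj₂ (inj₁ (WeakClosure-weak W r))
→w-weak W (inj₂ (inj₂ r)) = inj₂ (inj₂ (WeakClosure-weak W r))

normal-weak : (W : WCtx k l) → IsNormalForm _→w_ (W ⟨ t ⟩) → IsNormalForm _→w_ t
normal-weak W nf (_ , r) = nf (_ , →w-weak W r)

-- Typability of normal forms

data Answer {k : ℕ} : Tm k → Set where
  answer : (S : SCtx k l) (t : Tm (suc l)) → Answer (S ⟨ ƛ t ⟩ˢ)

data OccursWeakly {k : ℕ} (x : Fin k) : Tm k → Set where
  occurs : (W : WCtx k l) → OccursWeakly x (W ⟨⟨ var x ⟩⟩)

-- Emptiness is a propositional equality, so that it can be rewritten with; the other case provides
-- the weak context of an e-redex.
WeaklySupported : Ctx k → Tm k → Set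
WeaklySupported Γ t = ∀ x → Γ x ≡ [] ∨ OccursWeakly x t

Typable : Linear → Tm k → Set
Typable L t = ∃ λ Γ → (Γ ⊢ t ∶ L) × WeaklySupported Γ t

typable-var : (x : Fin k) → Typable L (var x)
typable-var {L = L} x = x ∶[ L ] , ax (λ _ → ↭-refl) , supp
  where
  supp : WeaklySupported (x ∶[ L ]) (var x)
  supp y with y ≟ x
  ... | yes refl = inj₂ (occurs ∙)
  ... | no y≢x   = inj₁ (∶ᴹ-away x y y≢x)

typable-ƛ : (t : Tm (suc k)) → Typable 𝚗 (ƛ t)
typable-ƛ t = ∅ , axλ (λ _ → ↭-refl) , λ _ → inj₁ refl

-- With the empty domain, the argument is typed exactly once, by the extra `𝚗` of the rule.
typable-· : Typable ([] ⊸ L) t → Typable 𝚗 u → Typable L (t · u)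
typable-· {t = t} {u = u} (Γ , d , s) (Δ , d′ , s′) =
  Γ ⊎ Δ , app Γ Δ d (singletonᴹ d′) (λ _ → ↭-refl) , supp
  where
  supp : WeaklySupported (Γ ⊎ Δ) (t · u)
  supp x with s x | s′ x
  ... | inj₂ (occurs W) | _               = inj₂ (occurs (W ·ˡ u))
  ... | inj₁ _          | inj₂ (occurs W) = inj₂ (occurs (t ·ʳ W))
  ... | inj₁ eq         | inj₁ eq′        rewrite eq | eq′ = inj₁ refl

bound-not-weak : IsNormalForm _→w_ (t [∖ u ]) → OccursWeakly zero t → ∀ {A : Set} → A
bound-not-weak nf (occurs W) = contradiction (_ , inj₂ (inj₁ (closure ∙ (↦e W _)))) nf

typable-[∖] : IsNormalForm _→w_ (t [∖ u ]) → Typable L t → Typable 𝚗 u → Typable L (t [∖ u ])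
typable-[∖] {t = t} {u = u} nf (Γ , d , s) (Δ , d′ , s′) =
  tail Γ ⊎ Δ , es Γ Δ d u∶ᴹ (λ _ → ↭-refl) , supp
  where
  u∶ᴹ : Δ ⊢ u ∶ᴹ head Γ ++ [ 𝚗 ]
  u∶ᴹ with s zero
  ... | inj₁ eq = subst (λ M → Δ ⊢ u ∶ᴹ M ++ [ 𝚗 ]) (sym eq) (singletonᴹ d′)
  ... | inj₂ o  = bound-not-weak nf o
  supp : WeaklySupported (tail Γ ⊎ Δ) (t [∖ u ])
  supp x with s (suc x) | s′ x
  ... | inj₂ (occurs W) | _               = inj₂ (occurs (W [∖ u ]ˡ))
  ... | inj₁ _          | inj₂ (occurs W) = inj₂ (occurs (t [∖ W ]ʳ))
  ... | inj₁ eq         | inj₁ eq′        rewrite eq | eq′ = inj₁ refl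

-- Type `𝚗` alone is too weak for the induction: a term in function position needs an arrow type.
-- Answers may lack one, but normality keeps them out of that position.
normal-typable : (t : Tm k) → IsNormalForm _→w_ t →
                 (Answer t × Typable 𝚗 t) ∨ (∀ L → Typable L t)
normal-typable-𝚗 : (t : Tm k) → IsNormalForm _→w_ t → Typable 𝚗 t

normal-typable (var x) nf = inj₂ λ L → typable-var x
normal-typable (ƛ t)   nf = inj₁ (answer ∙ t , typable-ƛ t)
normal-typable (t · u) nf with normal-typable t (normal-weak (∙ ·ˡ u) nf)
... | inj₁ (answer S b , _) = contradiction (_ , inj₁ (closure ∙ (↦m S b u))) nf
... | inj₂ f = inj₂ λ L → typable-· (f ([] ⊸ L)) (normal-typable-𝚗 u (normal-weak (t ·ʳ ∙) nf))
normal-typable (t [∖ u ]) nf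
  with normal-typable t (normal-weak (∙ [∖ u ]ˡ) nf) | normal-typable-𝚗 u (normal-weak (t [∖ ∙ ]ʳ) nf)
... | inj₁ (answer S b , d) | d′ = inj₁ (answer (S [∖ u ]) b , typable-[∖] nf d d′)
... | inj₂ f                | d′ = inj₂ λ L → typable-[∖] nf (f L) d′

normal-typable-𝚗 t nf with normal-typable t nf
... | inj₁ (_ , d) = d
... | inj₂ f       = f 𝚗

-- Expansion along reduction sequences

star-expansion : Star _→w_ t t′ → t′ ≼ t
star-expansion ε        d = d
star-expansion (r ◅ rs) d = subject-expansion r (star-expansion rs d)

theorem6p5 : ∀ {k : ℕ} (t n : Tm k) → Star _→w_ t n → IsNormalForm _→w_ n →
    ∃[ Γ ] ∃[ m ] ∃[ e ] (Γ ⊢⟨ m , e ⟩ t ∶ 𝚗)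
theorem6p5 t n t↠n nf with Γ , d , _ ← normal-typable-𝚗 n nf =
  Γ , derivable (star-expansion t↠n d)
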